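{- Let $n$ be a positive integer, let $D$ be the incidence matrix of a finite projective plane of order $n$, let $m=n^2+n+1$, and let $\vec{s}=(\tfrac1m,\tfrac1m,\dots,\tfrac1m)^T\in\mathbb{R}^m$. Then $(D,\vec{s})$ is an ATAC data distribution on $m$ machines with minimal data storage limit, i.e. $L(D,\vec{s})=L_{\min}(m)$.
   Context: A data distribution on $m$ machines is a pair $(D,\vec{s})$, where, for some positive integer $x$ (the number of data groups, not fixed in advance), $D=(d_{ij})$ is an $m\times x$ matrix with entries in $\{0,1\}$ ($d_{ij}=1$ iff data group $j$ is stored on machine $i$), and $\vec{s}\in\mathbb{R}^x$ is a column vector with non-negative entries summing to $1$ ($s_j$ is the fraction of all data lying in data group $j$). It is an ATAC (All-to-All Comparison) data distribution if every entry of $D^TD$ is nonzero, i.e. for every pair of data groups (including a group paired with itself) some machine holds both. The data storage limit of $(D,\vec{s})$ is $L(D,\vec{s})=\max_{1\le i\le m}(D\vec{s})_i$. The minimal data storage limit $L_{\min}(m)$ is the minimum of $L(D,\vec{s})$ over all ATAC data distributions on $m$ machines (over all $x$). A finite projective plane of order $n$ is a set of $n^2+n+1$ points and $n^2+n+1$ lines with an incidence relation such that: every pair of distinct points has exactly one line passing through both; every pair of distinct lines intersects in exactly one point; every line contains $n+1$ points; every point is on $n+1$ lines. (The triangle, $n=1$, is allowed.) Its incidence matrix has rows indexed by lines and columns indexed by points, with entry $1$ if the line contains the point and $0$ otherwise. -}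

module Defs where

open import Algebra.Bundles using (RawMonoid)
import Algebra.Definitions.RawMonoid as MonoidOps
open import Data.Bool.Base using (if_then_else_)
open import Data.Fin.Base using (Fin; toℕ)
open import Data.Fin.Patterns using (0F; 1F)
open import Data.Integer.Base using (+_)
open import Data.Nat.Base as ℕ using (ℕ; suc; NonZero)
import Data.Nat.Properties as ℕₚ
open import Data.Product using (∃; ∃-syntax; ∃!; _×_; _,_)
open import Data.Rational.Base as ℚ using (ℚ; 0ℚ; ½)
import Data.Rational.Properties as ℚₚ
open import Data.Rational.Solver using (module +-*-Solver)
open import Data.Sum.Base using (inj₁; inj₂)
open import Data.Vec.Base using (allFin; count)
open import Data.Vec.Functional using (Vector; foldr; head; tail; map; transpose)
open import Level using (0ℓ)
open import Relation.Binary.Core using (REL)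
open import Relation.Binary.Definitions using (Decidable)
open import Relation.Binary.PropositionalEquality
  using (_≡_; _≢_; refl; sym; trans; cong; subst)
open import Relation.Nullary.Decidable using (does)

------------------------------------------------------------------------
-- Real numbers: Cauchy sequences of rationals, with setoid equality _≈_

Eventually : (ℕ → Set) → Set
Eventually P = ∃[ N ] ∀ n → N ℕ.≤ n → P n

record ℝ : Set where
  constructor mkℝ
  field
    seq    : ℕ → ℚ
    cauchy : ∀ ε → 0ℚ ℚ.< ε →
             ∃[ N ] ∀ m n → N ℕ.≤ m → N ℕ.≤ n → ℚ.∣ seq m ℚ.- seq n ∣ ℚ.< ε

open ℝ public

infix 4 _≈_ _≤_

_≈_ : ℝ → ℝ → Set
a ≈ b = ∀ ε → 0ℚ ℚ.< ε → Eventually λ n → ℚ.∣ seq a n ℚ.- seq b n ∣ ℚ.< ε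

-- The non-strict order: limits preserve ≤ only up to every positive ε.
_≤_ : ℝ → ℝ → Set
a ≤ b = ∀ ε → 0ℚ ℚ.< ε → Eventually λ n → seq a n ℚ.< seq b n ℚ.+ ε

fromℚ : ℚ → ℝ
fromℚ q = mkℝ (λ _ → q) λ ε 0<ε →
  0 , λ _ _ _ _ → subst (ℚ._< ε) (cong ℚ.∣_∣ (sym (ℚₚ.+-inverseʳ q))) 0<ε

0ℝ 1ℝ : ℝ
0ℝ = fromℚ 0ℚ
1ℝ = fromℚ ℚ.1ℚ

-- Abstract because these proofs are slow to normalise.
private
  open +-*-Solver

  abstract
    0<½* : ∀ ε → 0ℚ ℚ.< ε → 0ℚ ℚ.< ½ ℚ.* ε
    0<½* ε 0<ε = subst (ℚ._< ½ ℚ.* ε) (ℚₚ.*-zeroʳ ½) (ℚₚ.*-monoʳ-<-pos ½ 0<ε)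

    halves : ∀ ε → ½ ℚ.* ε ℚ.+ ½ ℚ.* ε ≡ ε
    halves ε = trans (sym (ℚₚ.*-distribʳ-+ ε ½ ½)) (ℚₚ.*-identityˡ ε)

    ∣+∣-close : ∀ a b c d ε →
      ℚ.∣ a ℚ.- c ∣ ℚ.< ½ ℚ.* ε → ℚ.∣ b ℚ.- d ∣ ℚ.< ½ ℚ.* ε →
      ℚ.∣ (a ℚ.+ b) ℚ.- (c ℚ.+ d) ∣ ℚ.< ε
    ∣+∣-close a b c d ε p q = begin-strict
      ℚ.∣ (a ℚ.+ b) ℚ.- (c ℚ.+ d) ∣        ≡⟨ cong ℚ.∣_∣ (solve 4 (λ a b c d →
        (a :+ b) :- (c :+ d) := (a :- c) :+ (b :- d)) refl a b c d) ⟩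
      ℚ.∣ (a ℚ.- c) ℚ.+ (b ℚ.- d) ∣        ≤⟨ ℚₚ.∣p+q∣≤∣p∣+∣q∣ (a ℚ.- c) (b ℚ.- d) ⟩
      ℚ.∣ a ℚ.- c ∣ ℚ.+ ℚ.∣ b ℚ.- d ∣      <⟨ ℚₚ.+-mono-< p q ⟩
      ½ ℚ.* ε ℚ.+ ½ ℚ.* ε                  ≡⟨ halves ε ⟩
      ε                                    ∎
      where open ℚₚ.≤-Reasoning

    -‿swap : ∀ u v → ℚ.- (u ℚ.- v) ≡ v ℚ.- u
    -‿swap = solve 2 (λ u v → :- (u :- v) := v :- u) refl

    ∣-∣-comm : ∀ a b → ℚ.∣ a ℚ.- b ∣ ≡ ℚ.∣ b ℚ.- a ∣
    ∣-∣-comm a b = trans (cong ℚ.∣_∣ (sym (-‿swap b a))) (ℚₚ.∣-p∣≡∣p∣ (b ℚ.- a))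

    p≤∣p∣ : ∀ p → p ℚ.≤ ℚ.∣ p ∣
    p≤∣p∣ p with ℚₚ.≤-total 0ℚ p
    ... | inj₁ 0≤p = ℚₚ.≤-reflexive (sym (ℚₚ.0≤p⇒∣p∣≡p 0≤p))
    ... | inj₂ p≤0 = ℚₚ.≤-trans p≤0 (ℚₚ.0≤∣p∣ p)

    ∣-∣<⇒< : ∀ a c ε → ℚ.∣ a ℚ.- c ∣ ℚ.< ε → a ℚ.< c ℚ.+ ε
    ∣-∣<⇒< a c ε p = subst (ℚ._< c ℚ.+ ε)
      (solve 2 (λ a c → c :+ (a :- c) := a) refl a c)
      (ℚₚ.+-monoʳ-< c (ℚₚ.≤-<-trans (p≤∣p∣ (a ℚ.- c)) p))

    <⇒-< : ∀ a c ε → a ℚ.< c ℚ.+ ε → a ℚ.- c ℚ.< ε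
    <⇒-< a c ε p = subst (a ℚ.- c ℚ.<_)
      (solve 2 (λ c ε → c :+ ε :- c := ε) refl c ε)
      (ℚₚ.+-monoˡ-< (ℚ.- c) p)

    ⊔-<-+ : ∀ a b c d ε → a ℚ.< c ℚ.+ ε → b ℚ.< d ℚ.+ ε → a ℚ.⊔ b ℚ.< (c ℚ.⊔ d) ℚ.+ ε
    ⊔-<-+ a b c d ε p q with ℚₚ.⊔-sel a b
    ... | inj₁ e = subst (ℚ._< (c ℚ.⊔ d) ℚ.+ ε) (sym e) (ℚₚ.<-≤-trans p (ℚₚ.+-monoˡ-≤ ε (ℚₚ.p≤p⊔q c d)))
    ... | inj₂ e = subst (ℚ._< (c ℚ.⊔ d) ℚ.+ ε) (sym e) (ℚₚ.<-≤-trans q (ℚₚ.+-monoˡ-≤ ε (ℚₚ.p≤q⊔p c d)))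

    ∣⊔∣-close : ∀ a b c d ε →
      ℚ.∣ a ℚ.- c ∣ ℚ.< ε → ℚ.∣ b ℚ.- d ∣ ℚ.< ε → ℚ.∣ (a ℚ.⊔ b) ℚ.- (c ℚ.⊔ d) ∣ ℚ.< ε
    ∣⊔∣-close a b c d ε p q with ℚₚ.∣p∣≡p∨∣p∣≡-p ((a ℚ.⊔ b) ℚ.- (c ℚ.⊔ d))
    ... | inj₁ e = subst (ℚ._< ε) (sym e) (<⇒-< (a ℚ.⊔ b) (c ℚ.⊔ d) ε
      (⊔-<-+ a b c d ε (∣-∣<⇒< a c ε p) (∣-∣<⇒< b d ε q)))
    ... | inj₂ e = subst (ℚ._< ε)
      (sym (trans e (-‿swap (a ℚ.⊔ b) (c ℚ.⊔ d))))
      (<⇒-< (c ℚ.⊔ d) (a ℚ.⊔ b) ε (⊔-<-+ c d a b ε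
        (∣-∣<⇒< c a ε (subst (ℚ._< ε) (∣-∣-comm a c) p))
        (∣-∣<⇒< d b ε (subst (ℚ._< ε) (∣-∣-comm b d) q))))

infixl 6 _+_ _⊔_

_+_ : ℝ → ℝ → ℝ
a + b = mkℝ (λ n → seq a n ℚ.+ seq b n) λ ε 0<ε →
  let M , p = cauchy a (½ ℚ.* ε) (0<½* ε 0<ε)
      N , q = cauchy b (½ ℚ.* ε) (0<½* ε 0<ε)
  in M ℕ.⊔ N , λ m n u v →
    ∣+∣-close (seq a m) (seq b m) (seq a n) (seq b n) ε
      (p m n (ℕₚ.m⊔n≤o⇒m≤o M N u) (ℕₚ.m⊔n≤o⇒m≤o M N v))
      (q m n (ℕₚ.m⊔n≤o⇒n≤o M N u) (ℕₚ.m⊔n≤o⇒n≤o M N v))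

_⊔_ : ℝ → ℝ → ℝ
a ⊔ b = mkℝ (λ n → seq a n ℚ.⊔ seq b n) λ ε 0<ε →
  let M , p = cauchy a ε 0<ε
      N , q = cauchy b ε 0<ε
  in M ℕ.⊔ N , λ m n u v →
    ∣⊔∣-close (seq a m) (seq b m) (seq a n) (seq b n) ε
      (p m n (ℕₚ.m⊔n≤o⇒m≤o M N u) (ℕₚ.m⊔n≤o⇒m≤o M N v))
      (q m n (ℕₚ.m⊔n≤o⇒n≤o M N u) (ℕₚ.m⊔n≤o⇒n≤o M N v))

+-0-rawMonoid : RawMonoid 0ℓ 0ℓ
+-0-rawMonoid = record { Carrier = ℝ ; _≈_ = _≈_ ; _∙_ = _+_ ; ε = 0ℝ }

open MonoidOps +-0-rawMonoid public using () renaming (_×_ to _·_; sum to ∑)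
open MonoidOps ℕ.+-0-rawMonoid public using () renaming (sum to ∑ℕ)

maximum : ∀ {m} .{{_ : NonZero m}} → Vector ℝ m → ℝ
maximum {suc _} v = foldr _⊔_ (head v) (tail v)

------------------------------------------------------------------------
-- Data distributions

Matrix : Set → ℕ → ℕ → Set
Matrix A m x = Vector (Vector A x) m

-- Matrices with entries in {0,1}; row i is machine i, column j is data group j.
01Matrix : ℕ → ℕ → Set
01Matrix = Matrix (Fin 2)

entries : ∀ {m x} → 01Matrix m x → Matrix ℕ m x
entries = map (map toℕ)

_⊗_ : ∀ {l m x} → Matrix ℕ l m → Matrix ℕ m x → Matrix ℕ l x
(A ⊗ B) i k = ∑ℕ λ j → A i j ℕ.* B j k

-- The product D s: the entries of D act on ℝ as natural-number multiples.
_$ᵥ_ : ∀ {m x} → 01Matrix m x → Vector ℝ x → Vector ℝ m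
(D $ᵥ s) i = ∑ λ j → entries D i j · s j

IsATAC : ∀ {m x} → 01Matrix m x → Set
IsATAC D = ∀ j k → (transpose (entries D) ⊗ entries D) j k ≢ 0

record IsDataDistribution {m x} (D : 01Matrix m x) (s : Vector ℝ x) : Set where
  field
    x≢0         : NonZero x
    nonNegative : ∀ j → 0ℝ ≤ s j
    total       : ∑ s ≈ 1ℝ

record IsATACDataDistribution {m x} (D : 01Matrix m x) (s : Vector ℝ x) : Set where
  field
    isDataDistribution : IsDataDistribution D s
    isATAC             : IsATAC D

storageLimit : ∀ {m x} .{{_ : NonZero m}} → 01Matrix m x → Vector ℝ x → ℝ
storageLimit D s = maximum (D $ᵥ s)

-- ℓ is the minimum of the storage limit over all ATAC data distributions on m
-- machines, the number x of data groups being arbitrary.  A relation rather than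
-- a function of m, since the minimum over all x is not given by a computation.
record IsMinimalStorageLimit (m : ℕ) .{{_ : NonZero m}} (ℓ : ℝ) : Set where
  field
    attained   : ∃[ x ] ∃[ D ] ∃[ s ]
                 IsATACDataDistribution {m} {x} D s × storageLimit D s ≈ ℓ
    lowerBound : ∀ {x} (D : 01Matrix m x) (s : Vector ℝ x) →
                 IsATACDataDistribution D s → ℓ ≤ storageLimit D s

------------------------------------------------------------------------
-- Finite projective planes

planeSize : ℕ → ℕ
planeSize n = suc (n ℕ.^ 2 ℕ.+ n)

record ProjectivePlane (n : ℕ) : Set₁ where
  Point : Set
  Point = Fin (planeSize n)

  Line : Set
  Line = Fin (planeSize n)

  field
    _on_  : REL Point Line 0ℓ
    _on?_ : Decidable _on_

    joining      : ∀ {p q} → p ≢ q → ∃! _≡_ λ l → p on l × q on l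
    meeting      : ∀ {k l} → k ≢ l → ∃! _≡_ λ p → p on k × p on l
    pointsOnLine : ∀ l → count (_on? l) (allFin (planeSize n)) ≡ suc n
    linesOnPoint : ∀ p → count (p on?_) (allFin (planeSize n)) ≡ suc n

  infix 4 _on_ _on?_

incidenceMatrix : ∀ {n} → ProjectivePlane n → 01Matrix (planeSize n) (planeSize n)
incidenceMatrix P l p = if does (p on? l) then 1F else 0F
  where open ProjectivePlane P

uniform : ∀ m .{{_ : NonZero m}} → Vector ℝ m
uniform m _ = fromℚ (+ 1 ℚ./ m)

-- Linear programming duality.  Give machine i the weight w i ∈ ℕ.  If every column
-- of D has weighted sum at least c, then, since the s j sum to 1,
--   c ≤ ∑ⱼ (∑ᵢ w i d i j) s j = ∑ᵢ w i (D s)ᵢ ≤ (∑ᵢ w i) L(D, s).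
-- If all column sums are at least n + 1, the weights w = 1 give n + 1 ≤ m L.
-- Otherwise some group j lies on at most n machines; the ATAC condition says that
-- the weights w i = d i j are admissible for c = 1, so 1 ≤ n L, and again
-- n + 1 ≤ (n + 1) n L ≤ m L.  For a projective plane every load equals (n + 1)/m.

module Submission where

open import Defs
open import Algebra.Bundles using (CommutativeMonoid)
import Algebra.Properties.AbelianGroup as AbelianGroupProperties
import Algebra.Properties.CommutativeMonoid.Mult as CommutativeMonoidMult
import Algebra.Properties.CommutativeMonoid.Sum as CommutativeMonoidSum
import Algebra.Properties.CommutativeSemigroup as CommutativeSemigroupProperties
open import Data.Bool.Base using (true; false; if_then_else_)
open import Data.Fin.Base using (Fin; zero; suc; toℕ)
open import Data.Fin.Patterns using (0F; 1F)
open import Data.Fin.Properties using (_≟_; all?; ¬∀⟶∃¬)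
open import Data.Integer.Base as ℤ using (+_)
import Data.Integer.Properties as ℤₚ
import Data.Integer.Tactic.RingSolver as ℤ-Solver
open import Data.Nat.Base as ℕ using (ℕ; NonZero; suc)
import Data.Nat.Properties as ℕₚ
open import Data.Product using (_×_; _,_; proj₁; proj₂)
open import Data.Rational.Base as ℚ using (0ℚ; ½)
import Data.Rational.Properties as ℚₚ
open import Data.Rational.Unnormalised.Base as ℚᵘ using (mkℚᵘ; *≡*)
import Data.Rational.Unnormalised.Properties as ℚᵘₚ
open import Data.Sum.Base using (inj₁; inj₂)
open import Data.Vec.Base using (count; tabulate)
open import Data.Vec.Functional using (Vector; foldr; head; tail)
open import Function.Base using (_∘_; id)
open import Level using (0ℓ)
open import Relation.Binary.Bundles using (Poset)
open import Relation.Binary.PropositionalEquality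
  using (_≡_; refl; sym; trans; cong; cong₂; subst)
import Relation.Binary.Reasoning.PartialOrder as PartialOrderReasoning
open import Relation.Nullary.Decidable using (yes; no; does; dec-true)
open import Relation.Nullary.Negation using (contradiction)
open import Relation.Unary using (Pred; Decidable)

open AbelianGroupProperties ℚₚ.+-0-abelianGroup
  using (xyx⁻¹≈y; //-rightDividesˡ; ⁻¹-anti-homo-//)
open CommutativeSemigroupProperties
  (CommutativeMonoid.commutativeSemigroup ℚₚ.+-0-commutativeMonoid)
  using (interchange; xy∙z≈xz∙y)

-- The reals as an ordered commutative monoid

0<½*ε : ∀ {ε} → 0ℚ ℚ.< ε → 0ℚ ℚ.< ½ ℚ.* ε
0<½*ε {ε} 0<ε = subst (ℚ._< ½ ℚ.* ε) (ℚₚ.*-zeroʳ ½) (ℚₚ.*-monoʳ-<-pos ½ 0<ε)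

½*ε+½*ε≡ε : ∀ ε → ½ ℚ.* ε ℚ.+ ½ ℚ.* ε ≡ ε
½*ε+½*ε≡ε ε = trans (sym (ℚₚ.*-distribʳ-+ ε ½ ½)) (ℚₚ.*-identityˡ ε)

p≤∣p∣ : ∀ p → p ℚ.≤ ℚ.∣ p ∣
p≤∣p∣ p with ℚₚ.≤-total 0ℚ p
... | inj₁ 0≤p = ℚₚ.≤-reflexive (sym (ℚₚ.0≤p⇒∣p∣≡p 0≤p))
... | inj₂ p≤0 = ℚₚ.≤-trans p≤0 (ℚₚ.0≤∣p∣ p)

∣p-q∣<ε⇒p<q+ε : ∀ {p q ε} → ℚ.∣ p ℚ.- q ∣ ℚ.< ε → p ℚ.< q ℚ.+ ε
∣p-q∣<ε⇒p<q+ε {p} {q} {ε} close = begin-strict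
  p                    ≡⟨ //-rightDividesˡ q p ⟨
  (p ℚ.- q) ℚ.+ q      ≡⟨ ℚₚ.+-comm (p ℚ.- q) q ⟩
  q ℚ.+ (p ℚ.- q)      <⟨ ℚₚ.+-monoʳ-< q (ℚₚ.≤-<-trans (p≤∣p∣ (p ℚ.- q)) close) ⟩
  q ℚ.+ ε              ∎
  where open ℚₚ.≤-Reasoning

p<q+ε⇒p-q<ε : ∀ {p q ε} → p ℚ.< q ℚ.+ ε → p ℚ.- q ℚ.< ε
p<q+ε⇒p-q<ε {p} {q} {ε} p<q+ε =
  subst (p ℚ.- q ℚ.<_) (xyx⁻¹≈y q ε) (ℚₚ.+-monoˡ-< (ℚ.- q) p<q+ε)

p<q+ε∧q<p+ε⇒∣p-q∣<ε : ∀ {p q ε} → p ℚ.< q ℚ.+ ε → q ℚ.< p ℚ.+ ε → ℚ.∣ p ℚ.- q ∣ ℚ.< ε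
p<q+ε∧q<p+ε⇒∣p-q∣<ε {p} {q} {ε} p<q+ε q<p+ε with ℚₚ.∣p∣≡p∨∣p∣≡-p (p ℚ.- q)
... | inj₁ ∣p-q∣≡p-q = subst (ℚ._< ε) (sym ∣p-q∣≡p-q) (p<q+ε⇒p-q<ε p<q+ε)
... | inj₂ ∣p-q∣≡q-p =
  subst (ℚ._< ε) (sym (trans ∣p-q∣≡q-p (⁻¹-anti-homo-// p q))) (p<q+ε⇒p-q<ε q<p+ε)

eventually-zip : ∀ {P Q R : ℕ → Set} → (∀ {t} → P t → Q t → R t) →
                 Eventually P → Eventually Q → Eventually R
eventually-zip f (M , p) (N , q) = M ℕ.⊔ N , λ t M⊔N≤t →
  f (p t (ℕₚ.m⊔n≤o⇒m≤o M N M⊔N≤t)) (q t (ℕₚ.m⊔n≤o⇒n≤o M N M⊔N≤t))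

eventually-map : ∀ {P Q : ℕ → Set} → (∀ {t} → P t → Q t) → Eventually P → Eventually Q
eventually-map f (N , p) = N , λ t N≤t → f (p t N≤t)

-- _≤_ and _≈_ unfold to statements about seq, from which Agda cannot recover the
-- reals themselves; hence the explicit implicit arguments from here on.
pointwise-≤ : ∀ {a b} → (∀ t → seq a t ℚ.≤ seq b t) → a ≤ b
pointwise-≤ {a} {b} a≤b ε 0<ε = 0 , λ t _ →
  subst (ℚ._< seq b t ℚ.+ ε) (ℚₚ.+-identityʳ (seq a t)) (ℚₚ.+-mono-≤-< (a≤b t) 0<ε)

≈⇒≤ : ∀ {a b} → a ≈ b → a ≤ b
≈⇒≤ a≈b ε 0<ε = eventually-map ∣p-q∣<ε⇒p<q+ε (a≈b ε 0<ε)

≤-antisym : ∀ {a b} → a ≤ b → b ≤ a → a ≈ b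
≤-antisym a≤b b≤a ε 0<ε = eventually-zip p<q+ε∧q<p+ε⇒∣p-q∣<ε (a≤b ε 0<ε) (b≤a ε 0<ε)

≤-refl : ∀ {a} → a ≤ a
≤-refl {a} = pointwise-≤ {a} {a} λ _ → ℚₚ.≤-refl

≤-trans : ∀ {a b c} → a ≤ b → b ≤ c → a ≤ c
≤-trans {a} {b} {c} a≤b b≤c ε 0<ε =
  eventually-zip (λ {t} → chain t) (a≤b (½ ℚ.* ε) (0<½*ε 0<ε)) (b≤c (½ ℚ.* ε) (0<½*ε 0<ε))
  where
  open ℚₚ.≤-Reasoning
  chain : ∀ t → seq a t ℚ.< seq b t ℚ.+ ½ ℚ.* ε → seq b t ℚ.< seq c t ℚ.+ ½ ℚ.* ε →
          seq a t ℚ.< seq c t ℚ.+ ε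
  chain t p q = begin-strict
    seq a t                                <⟨ p ⟩
    seq b t ℚ.+ ½ ℚ.* ε                    <⟨ ℚₚ.+-monoˡ-< (½ ℚ.* ε) q ⟩
    seq c t ℚ.+ ½ ℚ.* ε ℚ.+ ½ ℚ.* ε        ≡⟨ ℚₚ.+-assoc (seq c t) (½ ℚ.* ε) (½ ℚ.* ε) ⟩
    seq c t ℚ.+ (½ ℚ.* ε ℚ.+ ½ ℚ.* ε)      ≡⟨ cong (seq c t ℚ.+_) (½*ε+½*ε≡ε ε) ⟩
    seq c t ℚ.+ ε                          ∎

≈-sym : ∀ {a b} → a ≈ b → b ≈ a
≈-sym {a} {b} a≈b ε 0<ε = eventually-map
  (λ {t} → subst (ℚ._< ε) (trans (sym (ℚₚ.∣-p∣≡∣p∣ (seq a t ℚ.- seq b t)))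
                                 (cong ℚ.∣_∣ (⁻¹-anti-homo-// (seq a t) (seq b t)))))
  (a≈b ε 0<ε)

≈⇒≥ : ∀ {a b} → a ≈ b → b ≤ a
≈⇒≥ {a} {b} a≈b = ≈⇒≤ {b} {a} (≈-sym {a} {b} a≈b)

pointwise-≈ : ∀ {a b} → (∀ t → seq a t ≡ seq b t) → a ≈ b
pointwise-≈ {a} {b} a≡b = ≤-antisym {a} {b}
  (pointwise-≤ {a} {b} (ℚₚ.≤-reflexive ∘ a≡b))
  (pointwise-≤ {b} {a} (ℚₚ.≤-reflexive ∘ sym ∘ a≡b))

-- Going through `≤-antisym` reuses the halving of `ε` in `≤-trans`, so absolute values need no
-- triangle inequality here. `+-cong` follows the same pattern.
≈-trans : ∀ {a b c} → a ≈ b → b ≈ c → a ≈ c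
≈-trans {a} {b} {c} a≈b b≈c = ≤-antisym {a} {c}
  (≤-trans {a} {b} {c} (≈⇒≤ {a} {b} a≈b) (≈⇒≤ {b} {c} b≈c))
  (≤-trans {c} {b} {a} (≈⇒≥ {b} {c} b≈c) (≈⇒≥ {a} {b} a≈b))

+-mono-≤ : ∀ {a b c d} → a ≤ b → c ≤ d → a + c ≤ b + d
+-mono-≤ {a} {b} {c} {d} a≤b c≤d ε 0<ε =
  eventually-zip (λ {t} → add t) (a≤b (½ ℚ.* ε) (0<½*ε 0<ε)) (c≤d (½ ℚ.* ε) (0<½*ε 0<ε))
  where
  open ℚₚ.≤-Reasoning
  add : ∀ t → seq a t ℚ.< seq b t ℚ.+ ½ ℚ.* ε → seq c t ℚ.< seq d t ℚ.+ ½ ℚ.* ε →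
        seq a t ℚ.+ seq c t ℚ.< seq b t ℚ.+ seq d t ℚ.+ ε
  add t p q = begin-strict
    seq a t ℚ.+ seq c t                                      <⟨ ℚₚ.+-mono-< p q ⟩
    (seq b t ℚ.+ ½ ℚ.* ε) ℚ.+ (seq d t ℚ.+ ½ ℚ.* ε)          ≡⟨ interchange (seq b t) (½ ℚ.* ε) (seq d t) (½ ℚ.* ε) ⟩
    (seq b t ℚ.+ seq d t) ℚ.+ (½ ℚ.* ε ℚ.+ ½ ℚ.* ε)          ≡⟨ cong (seq b t ℚ.+ seq d t ℚ.+_) (½*ε+½*ε≡ε ε) ⟩
    seq b t ℚ.+ seq d t ℚ.+ ε                                ∎

+-cong : ∀ {a b c d} → a ≈ b → c ≈ d → a + c ≈ b + d
+-cong {a} {b} {c} {d} a≈b c≈d = ≤-antisym {a + c} {b + d}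
  (+-mono-≤ {a} {b} {c} {d} (≈⇒≤ {a} {b} a≈b) (≈⇒≤ {c} {d} c≈d))
  (+-mono-≤ {b} {a} {d} {c} (≈⇒≥ {a} {b} a≈b) (≈⇒≥ {c} {d} c≈d))

≤-poset : Poset 0ℓ 0ℓ 0ℓ
≤-poset = record
  { Carrier        = ℝ
  ; _≈_            = _≈_
  ; _≤_            = _≤_
  ; isPartialOrder = record
    { isPreorder = record
      { isEquivalence = record
        { refl  = λ {a} → pointwise-≈ {a} {a} λ _ → refl
        ; sym   = λ {a} {b} → ≈-sym {a} {b}
        ; trans = λ {a} {b} {c} → ≈-trans {a} {b} {c}
        }
      ; reflexive = λ {a} {b} → ≈⇒≤ {a} {b}
      ; trans     = λ {a} {b} {c} → ≤-trans {a} {b} {c}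
      }
    ; antisym = λ {a} {b} → ≤-antisym {a} {b}
    }
  }

+-0-commutativeMonoid : CommutativeMonoid 0ℓ 0ℓ
+-0-commutativeMonoid = record
  { Carrier = ℝ
  ; _≈_     = _≈_
  ; _∙_     = _+_
  ; ε       = 0ℝ
  ; isCommutativeMonoid = record
    { isMonoid = record
      { isSemigroup = record
        { isMagma = record
          { isEquivalence = Poset.isEquivalence ≤-poset
          ; ∙-cong        = λ {a} {b} {c} {d} → +-cong {a} {b} {c} {d}
          }
        ; assoc = λ a b c → pointwise-≈ {a + b + c} {a + (b + c)}
                    λ t → ℚₚ.+-assoc (seq a t) (seq b t) (seq c t)
        }
      ; identity = (λ a → pointwise-≈ {0ℝ + a} {a} λ t → ℚₚ.+-identityˡ (seq a t))
                 , (λ a → pointwise-≈ {a + 0ℝ} {a} λ t → ℚₚ.+-identityʳ (seq a t))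
      }
    ; comm = λ a b → pointwise-≈ {a + b} {b + a} λ t → ℚₚ.+-comm (seq a t) (seq b t)
    }
  }

open CommutativeMonoid +-0-commutativeMonoid
  using () renaming (refl to ≈-refl; ∙-congˡ to +-congˡ; identityʳ to +-identityʳ)
open CommutativeMonoidMult +-0-commutativeMonoid
  using () renaming (×-homo-+ to ·-homo-+; ×-assocˡ to ·-assocˡ;
                     ×-distrib-+ to ·-distrib-+; ×-congʳ to ·-congʳ)
module ∑ = CommutativeMonoidSum +-0-commutativeMonoid
module ∑ℕ = CommutativeMonoidSum ℕₚ.+-0-commutativeMonoid
module ≤-Reasoning = PartialOrderReasoning ≤-poset

-- Natural multiples and finite sums of reals

·-monoʳ-≤ : ∀ k {a b} → a ≤ b → k · a ≤ k · b
·-monoʳ-≤ ℕ.zero            a≤b = ≤-refl {0ℝ}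
·-monoʳ-≤ (suc k) {a} {b} a≤b =
  +-mono-≤ {a} {b} {k · a} {k · b} a≤b (·-monoʳ-≤ k {a} {b} a≤b)

0≤k·a : ∀ k {a} → 0ℝ ≤ a → 0ℝ ≤ k · a
0≤k·a ℕ.zero        0≤a = ≤-refl {0ℝ}
0≤k·a (suc k) {a} 0≤a = +-mono-≤ {0ℝ} {a} {0ℝ} {k · a} 0≤a (0≤k·a k {a} 0≤a)

·-monoˡ-≤ : ∀ {j k a} → 0ℝ ≤ a → j ℕ.≤ k → j · a ≤ k · a
·-monoˡ-≤ {k = k} {a} 0≤a ℕ.z≤n = 0≤k·a k {a} 0≤a
·-monoˡ-≤ {suc j} {suc k} {a} 0≤a (ℕ.s≤s j≤k) =
  +-mono-≤ {a} {a} {j · a} {k · a} (≤-refl {a}) (·-monoˡ-≤ {j} {k} {a} 0≤a j≤k)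

-- A comparison at one fixed index `t`, without any `ε`. Cancellation below argues index by index,
-- where the order on `ℝ` says nothing.
seq-·-monoʳ-≤ : ∀ k {a b} t → seq a t ℚ.≤ seq b t → seq (k · a) t ℚ.≤ seq (k · b) t
seq-·-monoʳ-≤ ℕ.zero  t a≤b = ℚₚ.≤-refl
seq-·-monoʳ-≤ (suc k) {a} {b} t a≤b = ℚₚ.+-mono-≤ a≤b (seq-·-monoʳ-≤ k {a} {b} t a≤b)

-- No division is involved: the same `ε` and the same threshold work. If `b + ε` were at most `a` at
-- some index, then `k · b` would be at most `k · a` there, and adding the two contradicts the
-- hypothesis at that index.
·-cancelˡ-≤ : ∀ k {a b} → suc k · a ≤ suc k · b → a ≤ b
·-cancelˡ-≤ k {a} {b} ka≤kb ε 0<ε = eventually-map (λ {t} → cancel t) (ka≤kb ε 0<ε)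
  where
  open ℚₚ.≤-Reasoning
  cancel : ∀ t → seq (suc k · a) t ℚ.< seq (suc k · b) t ℚ.+ ε → seq a t ℚ.< seq b t ℚ.+ ε
  cancel t ka<kb+ε = ℚₚ.≰⇒> λ b+ε≤a → ℚₚ.<-irrefl refl (begin-strict
    seq a t ℚ.+ seq (k · a) t              <⟨ ka<kb+ε ⟩
    seq b t ℚ.+ seq (k · b) t ℚ.+ ε        ≡⟨ xy∙z≈xz∙y (seq b t) (seq (k · b) t) ε ⟩
    seq b t ℚ.+ ε ℚ.+ seq (k · b) t        ≤⟨ ℚₚ.+-mono-≤ b+ε≤a (seq-·-monoʳ-≤ k {b} {a} t (b≤a b+ε≤a)) ⟩
    seq a t ℚ.+ seq (k · a) t              ∎)
    where
    b≤a : seq b t ℚ.+ ε ℚ.≤ seq a t → seq b t ℚ.≤ seq a t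
    b≤a b+ε≤a = begin
      seq b t            ≡⟨ ℚₚ.+-identityʳ (seq b t) ⟨
      seq b t ℚ.+ 0ℚ     ≤⟨ ℚₚ.+-monoʳ-≤ (seq b t) (ℚₚ.<⇒≤ 0<ε) ⟩
      seq b t ℚ.+ ε      ≤⟨ b+ε≤a ⟩
      seq a t            ∎

∑-mono-≤ : ∀ {x} {u v : Vector ℝ x} → (∀ j → u j ≤ v j) → ∑ u ≤ ∑ v
∑-mono-≤ {ℕ.zero} u≤v = ≤-refl {0ℝ}
∑-mono-≤ {suc x} {u} {v} u≤v =
  +-mono-≤ {u zero} {v zero} {∑ (tail u)} {∑ (tail v)} (u≤v zero)
    (∑-mono-≤ {x} {tail u} {tail v} (u≤v ∘ suc))

·-distrib-∑ : ∀ k {x} (v : Vector ℝ x) → k · ∑ v ≈ ∑ λ j → k · v j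
·-distrib-∑ k {ℕ.zero} v = begin-equality
  -- `0ℝ` is definitionally `0 · 0ℝ`, which makes this an instance of associativity.
  k · 0ℝ      ≈⟨ ·-assocˡ 0ℝ k 0 ⟩
  (k ℕ.* 0) · 0ℝ ≡⟨ cong (_· 0ℝ) (ℕₚ.*-zeroʳ k) ⟩
  0ℝ          ∎
  where open ≤-Reasoning
·-distrib-∑ k {suc x} v = begin-equality
  k · (head v + ∑ (tail v))                 ≈⟨ ·-distrib-+ (head v) (∑ (tail v)) k ⟩
  k · head v + k · ∑ (tail v)               ≈⟨ +-congˡ {k · head v} {k · ∑ (tail v)} {∑ λ j → k · tail v j} (·-distrib-∑ k (tail v)) ⟩
  k · head v + ∑ (λ j → k · tail v j)       ∎
  where open ≤-Reasoning

-- Additivity of multiples in the coefficient. It lets column sums, row sums and total weights be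
-- computed in `ℕ` before acting on a real.
∑ℕ-homo-· : ∀ {m} (w : Vector ℕ m) a → ∑ℕ w · a ≈ ∑ λ i → w i · a
∑ℕ-homo-· {ℕ.zero} w a = ≈-refl {0ℝ}
∑ℕ-homo-· {suc m} w a = begin-equality
  (head w ℕ.+ ∑ℕ (tail w)) · a              ≈⟨ ·-homo-+ a (head w) (∑ℕ (tail w)) ⟩
  head w · a + ∑ℕ (tail w) · a              ≈⟨ +-congˡ {head w · a} {∑ℕ (tail w) · a} {∑ λ i → tail w i · a} (∑ℕ-homo-· (tail w) a) ⟩
  head w · a + ∑ (λ i → tail w i · a)       ∎
  where open ≤-Reasoning

-- Binary and finite maxima

a≤a⊔b : ∀ a b → a ≤ a ⊔ b
a≤a⊔b a b = pointwise-≤ {a} {a ⊔ b} λ t → ℚₚ.p≤p⊔q (seq a t) (seq b t)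

b≤a⊔b : ∀ a b → b ≤ a ⊔ b
b≤a⊔b a b = pointwise-≤ {b} {a ⊔ b} λ t → ℚₚ.p≤q⊔p (seq a t) (seq b t)

⊔-lub : ∀ {a b c} → a ≤ c → b ≤ c → a ⊔ b ≤ c
⊔-lub {a} {b} {c} a≤c b≤c ε 0<ε = eventually-zip (λ {t} → lub t) (a≤c ε 0<ε) (b≤c ε 0<ε)
  where
  lub : ∀ t → seq a t ℚ.< seq c t ℚ.+ ε → seq b t ℚ.< seq c t ℚ.+ ε →
        seq a t ℚ.⊔ seq b t ℚ.< seq c t ℚ.+ ε
  lub t p q with ℚₚ.⊔-sel (seq a t) (seq b t)
  ... | inj₁ a⊔b≡a = subst (ℚ._< seq c t ℚ.+ ε) (sym a⊔b≡a) p
  ... | inj₂ a⊔b≡b = subst (ℚ._< seq c t ℚ.+ ε) (sym a⊔b≡b) q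

-- `maximum` folds over the tail with the head as starting value, so this is what bounds entry zero.
base≤foldr-⊔ : ∀ {m} a (v : Vector ℝ m) → a ≤ foldr _⊔_ a v
base≤foldr-⊔ {ℕ.zero} a v = ≤-refl {a}
base≤foldr-⊔ {suc m} a v = begin
  a                                  ≤⟨ base≤foldr-⊔ a (tail v) ⟩
  foldr _⊔_ a (tail v)               ≤⟨ b≤a⊔b (head v) (foldr _⊔_ a (tail v)) ⟩
  head v ⊔ foldr _⊔_ a (tail v)      ∎
  where open ≤-Reasoning

entry≤foldr-⊔ : ∀ {m} a (v : Vector ℝ m) i → v i ≤ foldr _⊔_ a v
entry≤foldr-⊔ a v zero = a≤a⊔b (head v) (foldr _⊔_ a (tail v))
entry≤foldr-⊔ a v (suc i) = begin
  v (suc i)                          ≤⟨ entry≤foldr-⊔ a (tail v) i ⟩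
  foldr _⊔_ a (tail v)               ≤⟨ b≤a⊔b (head v) (foldr _⊔_ a (tail v)) ⟩
  head v ⊔ foldr _⊔_ a (tail v)      ∎
  where open ≤-Reasoning

foldr-⊔-lub : ∀ {m a b} (v : Vector ℝ m) → a ≤ b → (∀ i → v i ≤ b) → foldr _⊔_ a v ≤ b
foldr-⊔-lub {ℕ.zero} v a≤b v≤b = a≤b
foldr-⊔-lub {suc m} {a} {b} v a≤b v≤b =
  ⊔-lub {head v} {foldr _⊔_ a (tail v)} {b} (v≤b zero)
    (foldr-⊔-lub {m} {a} {b} (tail v) a≤b (v≤b ∘ suc))

entry≤maximum : ∀ {m} .{{_ : NonZero m}} (v : Vector ℝ m) i → v i ≤ maximum v
entry≤maximum {suc _} v zero    = base≤foldr-⊔ (head v) (tail v)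
entry≤maximum {suc _} v (suc i) = entry≤foldr-⊔ (head v) (tail v) i

maximum-lub : ∀ {m} .{{_ : NonZero m}} {v : Vector ℝ m} {b} → (∀ i → v i ≤ b) → maximum v ≤ b
maximum-lub {suc _} {v} {b} v≤b = foldr-⊔-lub {a = head v} {b} (tail v) (v≤b zero) (v≤b ∘ suc)

-- Multiples of the uniform fraction 1/m

toℚᵘ-k·1/m : ∀ k d t → ℚ.toℚᵘ (seq (k · fromℚ (+ 1 ℚ./ suc d)) t) ℚᵘ.≃ mkℚᵘ (+ k) d
toℚᵘ-k·1/m ℕ.zero d t = *≡* refl
toℚᵘ-k·1/m (suc k) d t = begin-equality
  -- Addition in `ℚ` reduces every partial sum to lowest terms. Among unnormalised fractions the
  -- induction step is just 1/b + a/b = (1 + a)/b, a ring identity after cross-multiplying.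
  ℚ.toℚᵘ (+ 1 ℚ./ suc d ℚ.+ k/m)              ≃⟨ ℚₚ.toℚᵘ-homo-+ (+ 1 ℚ./ suc d) k/m ⟩
  ℚ.toℚᵘ (+ 1 ℚ./ suc d) ℚᵘ.+ ℚ.toℚᵘ k/m      ≃⟨ ℚᵘₚ.+-cong (ℚₚ.toℚᵘ-fromℚᵘ (mkℚᵘ (+ 1) d)) (toℚᵘ-k·1/m k d t) ⟩
  mkℚᵘ (+ 1) d ℚᵘ.+ mkℚᵘ (+ k) d              ≃⟨ *≡* (same-denominator (+ k) (+ suc d)) ⟩
  mkℚᵘ (+ suc k) d                            ∎
  where
  open ℚᵘₚ.≤-Reasoning
  k/m = seq (k · fromℚ (+ 1 ℚ./ suc d)) t
  same-denominator : ∀ a b → (+ 1 ℤ.* b ℤ.+ a ℤ.* b) ℤ.* b ≡ (+ 1 ℤ.+ a) ℤ.* (b ℤ.* b)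
  same-denominator = ℤ-Solver.solve-∀

m·1/m≈1 : ∀ m .{{_ : NonZero m}} → m · fromℚ (+ 1 ℚ./ m) ≈ 1ℝ
m·1/m≈1 (suc d) = pointwise-≈ {suc d · fromℚ (+ 1 ℚ./ suc d)} {1ℝ} λ t →
  ℚₚ.toℚᵘ-injective (ℚᵘₚ.≃-trans (toℚᵘ-k·1/m (suc d) d t) (*≡* (ℤₚ.*-comm (+ suc d) (+ 1))))

0≤1/m : ∀ m .{{_ : NonZero m}} → 0ℝ ≤ fromℚ (+ 1 ℚ./ m)
0≤1/m m = pointwise-≤ {0ℝ} {fromℚ (+ 1 ℚ./ m)} λ _ →
  ℚₚ.nonNegative⁻¹ (+ 1 ℚ./ m) {{ℚₚ.normalize-nonNeg 1 m}}

-- Lower bounds for the storage limit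

-- Weak duality, by summing the weighted loads in both orders. The weights are natural numbers so
-- that they act on reals as multiples. `w` is left free because two choices are made later: all
-- ones, and a column of `D`.
weighted-lowerBound :
  ∀ {m x} .{{_ : NonZero m}} (D : 01Matrix m x) (s : Vector ℝ x) →
  IsDataDistribution D s → (w : Vector ℕ m) (c : ℕ) →
  (∀ j → c ℕ.≤ ∑ℕ λ i → w i ℕ.* entries D i j) →
  c · 1ℝ ≤ ∑ℕ w · storageLimit D s
weighted-lowerBound D s dist w c c≤columns = begin
  c · 1ℝ                                                ≈⟨ ·-congʳ c {∑ s} {1ℝ} total ⟨
  c · ∑ s                                               ≈⟨ ·-distrib-∑ c s ⟩
  ∑ (λ j → c · s j)                                     ≤⟨ ∑-mono-≤ {u = λ j → c · s j} {λ j → column j · s j}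
                                                             (λ j → ·-monoˡ-≤ {a = s j} (nonNegative j) (c≤columns j)) ⟩
  ∑ (λ j → column j · s j)                              ≈⟨ ∑.sum-cong-≋ (λ j → ∑ℕ-homo-· (λ i → w i ℕ.* entries D i j) (s j)) ⟩
  ∑ (λ j → ∑ λ i → (w i ℕ.* entries D i j) · s j)       ≈⟨ ∑.∑-comm (λ j i → (w i ℕ.* entries D i j) · s j) ⟩
  ∑ (λ i → ∑ λ j → (w i ℕ.* entries D i j) · s j)       ≈⟨ ∑.sum-cong-≋ (λ i → ∑.sum-cong-≋ λ j → ·-assocˡ (s j) (w i) (entries D i j)) ⟨
  ∑ (λ i → ∑ λ j → w i · (entries D i j · s j))         ≈⟨ ∑.sum-cong-≋ (λ i → ·-distrib-∑ (w i) (λ j → entries D i j · s j)) ⟨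
  ∑ (λ i → w i · (D $ᵥ s) i)                            ≤⟨ ∑-mono-≤ {u = λ i → w i · (D $ᵥ s) i} {λ i → w i · L}
                                                             (λ i → ·-monoʳ-≤ (w i) {(D $ᵥ s) i} {L} (entry≤maximum (D $ᵥ s) i)) ⟩
  ∑ (λ i → w i · L)                                     ≈⟨ ∑ℕ-homo-· w L ⟨
  ∑ℕ w · L                                              ∎
  where
  open ≤-Reasoning
  open IsDataDistribution dist
  L = storageLimit D s
  column : _ → ℕ
  column j = ∑ℕ λ i → w i ℕ.* entries D i j

-- Needed to enlarge the coefficient of the storage limit in an upper bound. The load of any one
-- machine is a witness; machine `zero` is taken.
0≤storageLimit : ∀ {m x} .{{_ : NonZero m}} (D : 01Matrix m x) (s : Vector ℝ x) →
                 (∀ j → 0ℝ ≤ s j) → 0ℝ ≤ storageLimit D s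
0≤storageLimit {suc _} {x} D s 0≤s = begin
  0ℝ                                ≈⟨ ∑.sum-replicate-zero x ⟨
  ∑ (λ (_ : Fin x) → 0ℝ)            ≤⟨ ∑-mono-≤ {u = λ _ → 0ℝ} {λ j → entries D zero j · s j}
                                         (λ j → 0≤k·a (entries D zero j) {s j} (0≤s j)) ⟩
  (D $ᵥ s) zero                     ≤⟨ entry≤maximum (D $ᵥ s) zero ⟩
  storageLimit D s                  ∎
  where open ≤-Reasoning

∑ℕ-ones : ∀ m → ∑ℕ {m} (λ _ → 1) ≡ m
∑ℕ-ones ℕ.zero  = refl
∑ℕ-ones (suc m) = cong suc (∑ℕ-ones m)

-- The left side is exactly `planeSize n` minus one, so the case of a thin column closes with one
-- unit to spare.
suc-n*n≤planeSize : ∀ n → suc n ℕ.* n ℕ.≤ planeSize n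
suc-n*n≤planeSize n = begin
  n ℕ.+ n ℕ.* n          ≡⟨ ℕₚ.+-comm n (n ℕ.* n) ⟩
  -- `n ^ 2` unfolds to `n * (n * 1)`.
  n ℕ.* n ℕ.+ n          ≡⟨ cong (λ k → n ℕ.* k ℕ.+ n) (ℕₚ.*-identityʳ n) ⟨
  n ℕ.^ 2 ℕ.+ n          ≤⟨ ℕₚ.n≤1+n _ ⟩
  planeSize n            ∎
  where open ℕₚ.≤-Reasoning

-- The bound (n + 1)/m with its denominator cleared. The case split is on column sums, which are
-- natural numbers, so it is decidable although comparison of reals is not.
planeSize-lowerBound :
  ∀ n {x} (D : 01Matrix (planeSize n) x) (s : Vector ℝ x) → IsATACDataDistribution D s →
  suc n · 1ℝ ≤ planeSize n · storageLimit D s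
planeSize-lowerBound n {x} D s atac with all? (λ j → suc n ℕₚ.≤? ∑ℕ λ i → entries D i j)
... | yes large = begin
  suc n · 1ℝ                        ≤⟨ weighted-lowerBound D s isDataDistribution (λ _ → 1) (suc n) columns ⟩
  ∑ℕ {planeSize n} (λ _ → 1) · L    ≡⟨ cong (_· L) (∑ℕ-ones (planeSize n)) ⟩
  planeSize n · L                   ∎
  where
  open ≤-Reasoning
  open IsATACDataDistribution atac
  L = storageLimit D s
  columns : ∀ j → suc n ℕ.≤ ∑ℕ λ i → 1 ℕ.* entries D i j
  columns j = subst (suc n ℕ.≤_)
    (∑ℕ.sum-cong-≗ λ i → sym (ℕₚ.*-identityˡ (entries D i j))) (large j)
... | no ¬large = begin
  suc n · 1ℝ                        ≤⟨ ·-monoʳ-≤ (suc n) {1ℝ} {n · L} 1≤n·L ⟩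
  suc n · (n · L)                   ≈⟨ ·-assocˡ L (suc n) n ⟩
  (suc n ℕ.* n) · L                 ≤⟨ ·-monoˡ-≤ {a = L} 0≤L (suc-n*n≤planeSize n) ⟩
  planeSize n · L                   ∎
  where
  open ≤-Reasoning
  open IsATACDataDistribution atac
  open IsDataDistribution isDataDistribution
  L = storageLimit D s
  0≤L = 0≤storageLimit D s nonNegative
  -- There are finitely many groups, so the failed test yields an actual group `j₀` with column sum
  -- at most `n`.
  small = ¬∀⟶∃¬ x _ (λ j → suc n ℕₚ.≤? ∑ℕ λ i → entries D i j) ¬large
  j₀ = proj₁ small
  1≤n·L : 1ℝ ≤ n · L
  1≤n·L = begin
    1ℝ                                ≈⟨ +-identityʳ 1ℝ ⟨
    1 · 1ℝ                            ≤⟨ weighted-lowerBound D s isDataDistribution (λ i → entries D i j₀) 1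
                                           -- With column `j₀` as weights, the weighted sum of
                                           -- column `k` is by definition the `(j₀ , k)` entry of
                                           -- the product of the transpose of `D` with `D`.
                                           (λ k → ℕₚ.n≢0⇒n>0 (isATAC j₀ k)) ⟩
    ∑ℕ (λ i → entries D i j₀) · L     ≤⟨ ·-monoˡ-≤ {a = L} 0≤L (ℕₚ.≮⇒≥ (proj₂ small)) ⟩
    n · L                             ∎

-- Projective planes

-- The summand has the shape of an entry of `incidenceMatrix`, and `allFin` is `tabulate id`. The
-- two counting axioms of a plane thereby become row and column sums.
count-tabulate : ∀ {A : Set} {P : Pred A 0ℓ} (P? : Decidable P) {m} (f : Fin m → A) →
                 count P? (tabulate f) ≡ ∑ℕ λ i → toℕ {2} (if does (P? (f i)) then 1F else 0F)
count-tabulate P? {ℕ.zero} f = refl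
count-tabulate P? {suc m} f with does (P? (f zero))
... | true  = cong suc (count-tabulate P? (f ∘ suc))
... | false = count-tabulate P? (f ∘ suc)

entry≤∑ℕ : ∀ {m} (v : Vector ℕ m) i → v i ℕ.≤ ∑ℕ v
entry≤∑ℕ v zero    = ℕₚ.m≤m+n (v zero) _
entry≤∑ℕ v (suc i) = ℕₚ.≤-trans (entry≤∑ℕ (tail v) i) (ℕₚ.m≤n+m _ (v zero))

-- Makes each diagonal entry in the ATAC condition, a sum of squares of bits, equal to a column sum.
bit-idem : ∀ (e : Fin 2) → toℕ e ≡ toℕ e ℕ.* toℕ e
bit-idem 0F = refl
bit-idem 1F = refl

module _ {n} (P : ProjectivePlane n) where
  open ProjectivePlane P
  private
    m = planeSize n
    D = incidenceMatrix P
    s = uniform m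
    1/m = fromℚ (+ 1 ℚ./ m)

  rowSum : ∀ l → ∑ℕ (λ p → entries D l p) ≡ suc n
  rowSum l = trans (sym (count-tabulate (_on? l) id)) (pointsOnLine l)

  columnSum : ∀ p → ∑ℕ (λ l → entries D l p) ≡ suc n
  columnSum p = trans (sym (count-tabulate (p on?_) id)) (linesOnPoint p)

  on⇒entry≡1 : ∀ {p l} → p on l → entries D l p ≡ 1
  on⇒entry≡1 {p} {l} p∈l = cong (λ b → toℕ {2} (if b then 1F else 0F)) (dec-true (p on? l) p∈l)

  -- On the diagonal the entry is the number of lines through the point, which is `suc n`. Off the
  -- diagonal the line joining the two points already contributes 1.
  incidenceMatrix-isATAC : IsATAC D
  incidenceMatrix-isATAC p q with p ≟ q
  ... | yes refl = λ ≡0 → contradiction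
    (trans (sym (columnSum p)) (trans (∑ℕ.sum-cong-≗ λ l → bit-idem (D l p)) ≡0)) λ ()
  ... | no p≢q =
    let l , (p∈l , q∈l) , _ = joining p≢q
        1≤ = subst (ℕ._≤ ∑ℕ λ l → entries D l p ℕ.* entries D l q) (cong₂ ℕ._*_ (on⇒entry≡1 p∈l) (on⇒entry≡1 q∈l))
               (entry≤∑ℕ (λ l → entries D l p ℕ.* entries D l q) l)
    in ℕₚ.m<n⇒n≢0 1≤

  incidenceMatrix-isATACDataDistribution : IsATACDataDistribution D s
  incidenceMatrix-isATACDataDistribution = record
    { isDataDistribution = record
      { x≢0         = _
      ; nonNegative = λ _ → 0≤1/m m
      ; total       = begin-equality
          ∑ s          ≈⟨ ∑.sum-replicate m {1/m} ⟩
          m · 1/m      ≈⟨ m·1/m≈1 m ⟩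
          1ℝ           ∎
      }
    ; isATAC = incidenceMatrix-isATAC
    }
    where open ≤-Reasoning

  -- Every line has `suc n` points, so under uniform `s` all loads are equal to `suc n · 1/m`.
  -- Minimality needs only this upper bound.
  m·storageLimit≤suc-n : m · storageLimit D s ≤ suc n · 1ℝ
  m·storageLimit≤suc-n = begin
    m · storageLimit D s           ≤⟨ ·-monoʳ-≤ m {storageLimit D s} {suc n · 1/m}
                                        (maximum-lub {v = D $ᵥ s} {suc n · 1/m} load≤) ⟩
    -- The two multipliers are exchanged so that `m` meets `1/m` and cancels.
    m · (suc n · 1/m)              ≈⟨ ·-assocˡ 1/m m (suc n) ⟩
    (m ℕ.* suc n) · 1/m            ≡⟨ cong (_· 1/m) (ℕₚ.*-comm m (suc n)) ⟩
    (suc n ℕ.* m) · 1/m            ≈⟨ ·-assocˡ 1/m (suc n) m ⟨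
    suc n · (m · 1/m)              ≈⟨ ·-congʳ (suc n) {m · 1/m} {1ℝ} (m·1/m≈1 m) ⟩
    suc n · 1ℝ                     ∎
    where
    open ≤-Reasoning
    load≤ : ∀ l → (D $ᵥ s) l ≤ suc n · 1/m
    load≤ l = begin
      (D $ᵥ s) l                         ≈⟨ ∑ℕ-homo-· (entries D l) 1/m ⟨
      ∑ℕ (entries D l) · 1/m             ≡⟨ cong (_· 1/m) (rowSum l) ⟩
      suc n · 1/m                        ∎

  storageLimit-isMinimal : IsMinimalStorageLimit m (storageLimit D s)
  storageLimit-isMinimal = record
    { attained   = m , D , s , incidenceMatrix-isATACDataDistribution
                 , ≈-refl {storageLimit D s}
    ; lowerBound = λ D′ s′ atac →
        -- The common factor is `m`; cancellation takes its predecessor. The two bounds meet at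
        -- `suc n · 1ℝ`.
        ·-cancelˡ-≤ (n ℕ.^ 2 ℕ.+ n) {storageLimit D s} {storageLimit D′ s′}
          (≤-trans {m · storageLimit D s} {suc n · 1ℝ} {m · storageLimit D′ s′}
            m·storageLimit≤suc-n (planeSize-lowerBound n D′ s′ atac))
    }

theorem8 : ∀ (n : ℕ) .{{_ : NonZero n}} (P : ProjectivePlane n) →
    let m = planeSize n
        D = incidenceMatrix P
        s = uniform m
    in IsATACDataDistribution D s × IsMinimalStorageLimit m (storageLimit D s)
theorem8 n P = incidenceMatrix-isATACDataDistribution P , storageLimit-isMinimal P
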